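{- Let $G=(V,E)$ be a connected chordal graph with at least two vertices and let $v\in V$. Then: (1) $v\in\mathrm{core}(G)$ if and only if $v\in V^+$; (2) $v\in\mathrm{anticore}(G)$ if and only if $\gamma(G_v+u)=\gamma(G)+1$; (3) $v\in\mathrm{corona}(G)\setminus\mathrm{core}(G)$ if and only if either $v\in V^-$, or $v\in V^0$ and $\gamma(G_v+u)=\gamma(G)$.
   Context: All graphs are finite, simple and undirected. A graph is chordal if it has no induced cycle of length at least four. $\gamma(G)$ is the domination number; a minimum dominating set (mds) is a dominating set of size $\gamma(G)$. $\mathrm{core}(G)$ is the set of vertices in every mds, $\mathrm{corona}(G)$ the set of vertices in at least one mds, $\mathrm{anticore}(G)=V\setminus\mathrm{corona}(G)$. With $G-v$ denoting $G$ with $v$ deleted: $V^+=\{v:\gamma(G-v)>\gamma(G)\}$, $V^0=\{v:\gamma(G-v)=\gamma(G)\}$, $V^-=\{v:\gamma(G-v)<\gamma(G)\}$. $G_v+u$ is the graph obtained from $G$ by adding a new vertex $u$ and the single edge $uv$. -}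

module Defs where

open import Data.Empty using (⊥)
open import Data.Fin using (Fin; zero; suc; toℕ; punchIn)
open import Data.Fin.Properties using (_≟_; any?; all?)
open import Data.Fin.Subset using (Subset; _∈_; ∣_∣; ⊤)
open import Data.Fin.Subset.Properties using (_∈?_; ∈⊤; anySubset?)
open import Data.Nat using (ℕ; suc; pred; _≤_; _<_; _<?_)
open import Data.Nat.Induction using (Acc; acc; <-wellFounded)
open import Data.Nat.Properties using (≮⇒≥)
open import Data.Product using (∃-syntax; _×_; _,_; proj₁)
open import Data.Sum using (_⊎_; inj₁)
open import Function.Bundles using (_⇔_)
open import Function.Definitions using (Injective)
open import Level using (0ℓ)
open import Relation.Binary.Construct.Closure.ReflexiveTransitive using (Star)
import Relation.Binary.Definitions as B
open import Relation.Binary.PropositionalEquality using (_≡_; refl)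
open import Relation.Nullary using (¬_; yes; no; _×-dec_; _⊎-dec_)
open import Relation.Unary using (Pred; Decidable; ∁)

record Graph (n : ℕ) : Set₁ where
  field
    Adj    : Fin n → Fin n → Set
    adj?   : B.Decidable Adj
    sym    : B.Symmetric Adj
    irrefl : ∀ {x} → ¬ Adj x x

open Graph public using (Adj; adj?)

private variable
  n : ℕ

Connected : Graph n → Set
Connected G = ∀ x y → Star (Adj G) x y

-- The successor relation of the cyclic order 0, 1, …, k-1, 0.
CyclicSuc : ∀ k → Fin k → Fin k → Set
CyclicSuc k i j = toℕ j ≡ suc (toℕ i) ⊎ (suc (toℕ i) ≡ k × toℕ j ≡ 0)

-- For k ≥ 3 this is the adjacency relation of the cycle of length k.
CycleAdj : ∀ k → Fin k → Fin k → Set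
CycleAdj k i j = CyclicSuc k i j ⊎ CyclicSuc k j i

InducedCycle : Graph n → ℕ → Set
InducedCycle {n} G k =
  ∃[ c ] (Injective {A = Fin k} {B = Fin n} _≡_ _≡_ c
         × (∀ i j → Adj G (c i) (c j) ⇔ CycleAdj k i j))

Chordal : Graph n → Set
Chordal G = ∀ k → 4 ≤ k → ¬ InducedCycle G k

Dominating : Graph n → Subset n → Set
Dominating G S = ∀ x → x ∈ S ⊎ (∃[ y ] (y ∈ S × Adj G x y))

dominating? : (G : Graph n) → Decidable (Dominating G)
dominating? G S =
  all? λ x → (x ∈? S) ⊎-dec any? (λ y → (y ∈? S) ×-dec adj? G x y)

smallestDominating : (G : Graph n) →
  ∃[ S ] (Dominating G S × (∀ T → Dominating G T → ∣ S ∣ ≤ ∣ T ∣))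
smallestDominating {n} G = descend ⊤ (λ _ → inj₁ ∈⊤) (<-wellFounded ∣ ⊤ {n} ∣)
  where
  descend : ∀ S → Dominating G S → Acc _<_ ∣ S ∣ →
    ∃[ S ] (Dominating G S × (∀ T → Dominating G T → ∣ S ∣ ≤ ∣ T ∣))
  descend S dom (acc rec)
    with anySubset? (λ T → dominating? G T ×-dec (∣ T ∣ <? ∣ S ∣))
  ... | yes (T , domT , T<S) = descend T domT (rec T<S)
  ... | no  none = S , dom , λ T domT → ≮⇒≥ (λ T<S → none (T , domT , T<S))

γ : Graph n → ℕ
γ G = ∣ proj₁ (smallestDominating G) ∣

γ-minimum : (G : Graph n) →
  (∃[ S ] (Dominating G S × ∣ S ∣ ≡ γ G)) × (∀ T → Dominating G T → γ G ≤ ∣ T ∣)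
γ-minimum G with S , dom , least ← smallestDominating G =
  (S , dom , refl) , least

IsMDS : Graph n → Subset n → Set
IsMDS G S = Dominating G S × ∣ S ∣ ≡ γ G

core : Graph n → Pred (Fin n) 0ℓ
core G v = ∀ S → IsMDS G S → v ∈ S

corona : Graph n → Pred (Fin n) 0ℓ
corona G v = ∃[ S ] (IsMDS G S × v ∈ S)

anticore : Graph n → Pred (Fin n) 0ℓ
anticore G = ∁ (corona G)

-- Vertex deletion; punchIn v enumerates the vertices other than v.
infixl 6 _-_
_-_ : Graph n → Fin n → Graph (pred n)
_-_ {suc n} G v = record
  { Adj    = λ x y → Adj G (punchIn v x) (punchIn v y)
  ; adj?   = λ x y → adj? G (punchIn v x) (punchIn v y)
  ; sym    = Graph.sym G
  ; irrefl = Graph.irrefl G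
  }

V⁺ V⁰ V⁻ : Graph n → Pred (Fin n) 0ℓ
V⁺ G v = γ G < γ (G - v)
V⁰ G v = γ (G - v) ≡ γ G
V⁻ G v = γ (G - v) < γ G

-- The graph G_v + u: the new vertex u is zero and each old vertex x is suc x.
addLeaf : Graph n → Fin n → Graph (suc n)
addLeaf {n} G v = record
  { Adj = A ; adj? = A? ; sym = λ {x} {y} → A-sym x y ; irrefl = λ {x} → A-irrefl x }
  where
  A : Fin (suc n) → Fin (suc n) → Set
  A zero    zero    = ⊥
  A zero    (suc y) = y ≡ v
  A (suc x) zero    = x ≡ v
  A (suc x) (suc y) = Adj G x y

  A? : B.Decidable A
  A? zero    zero    = no λ ()
  A? zero    (suc y) = y ≟ v
  A? (suc x) zero    = x ≟ v
  A? (suc x) (suc y) = adj? G x y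

  A-sym : ∀ x y → A x y → A y x
  A-sym zero    (suc y) p = p
  A-sym (suc x) zero    p = p
  A-sym (suc x) (suc y) p = Graph.sym G p

  A-irrefl : ∀ x → ¬ A x x
  A-irrefl (suc x) p = Graph.irrefl G p

{-# OPTIONS --safe #-}

-- In any graph γ(G_v + u) is the least size of a dominating set containing v, which gives (2);
-- V⁺ ⊆ core also holds in any graph, and (3) follows from (1), (2) and V⁻ ⊆ corona.
-- For core ⊆ V⁺, let v lie in every mds, let S be an mds, and suppose that D avoids v,
-- dominates G - v and has |D| ≤ γ(G).  Then D misses N[v], as otherwise D would be an mds
-- without v.  Let R = V ∖ N[v].  If Q ⊆ R is a union of components of G[R], each attached to
-- some vertex of a nonempty set B ⊆ N(v) containing all vertices of S ∩ N(v) with a neighbour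
-- in Q, then (D ∖ Q) ∪ (S ∩ Q) ∪ B dominates G: neighbours of v attached to a common component
-- of G[R] are adjacent by chordality.  Since this set avoids v, |D ∩ Q| < |S ∩ Q| + |B|.
-- Apply this with B = S ∩ N(v) to the components attached to S ∩ N(v), and with singletons B
-- to the others.  Summing up gives |D| < |S| = γ(G), but then D together with a neighbour of v
-- is an mds without v.
module Submission where

open import Defs
open import Data.Empty using (⊥; ⊥-elim)
open import Data.Nat using (ℕ; zero; suc; _+_; _≤_; _<_; z≤n; s≤s; _≤?_)
open import Data.Nat.Properties using
  ( ≤-reflexive; ≤-trans; ≤-antisym; ≤-<-trans; <⇒≤; <⇒≱; <-irrefl; ≤-pred
  ; ≰⇒>; ≮⇒≥; ≤∧≢⇒<; n≤1+n; m≤m+n; m≢1+m+n; m≤n⇒m<n∨m≡n; <-asym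
  ; suc-injective; +-comm; +-suc; +-mono-≤; +-monoʳ-≤; +-cancelˡ-<; module ≤-Reasoning)
open import Data.Fin using (Fin; zero; suc; toℕ; punchIn; punchOut)
open import Data.Fin.Properties using (_≟_; punchIn-punchOut; punchInᵢ≢i)
open import Data.Fin.Subset
  using (Subset; inside; outside; _⊆_; _∩_; _∪_; ∁; ⁅_⁆; ∣_∣; Nonempty)
  renaming (_∈_ to _∈ₛ_; _∉_ to _∉ₛ_; _-_ to _-ₛ_)
open import Data.Fin.Subset.Properties using
  ( _∈?_; nonempty?; x∈⁅x⁆; x∈⁅y⁆⇒x≡y; ∣⁅x⁆∣≡1; p⊆q⇒∣p∣≤∣q∣; x∈p∩q⁺; x∈p∩q⁻; x∈p∪q⁺; x∈p∪q⁻
  ; p⊆p∪q; q⊆p∪q; p∩q⊆p; x∈∁p⇒x∉p; x∉p⇒x∈∁p; ∩-assoc; drop-there; x∈p∧x≢y⇒x∈p-y; x∈p⇒∣p-x∣<∣p∣)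
open import Data.List using (List; []; _∷_; [_]; length; lookup; allFin)
open import Data.List.Membership.Propositional using (lose) renaming (_∈_ to _∈ₗ_)
open import Data.List.Membership.Propositional.Properties using (∈-allFin; ∈-lookup)
open import Data.List.Relation.Unary.All as All using (All; []; _∷_)
open import Data.List.Relation.Unary.All.Properties using (¬Any⇒All¬; All¬⇒¬Any)
open import Data.List.Relation.Unary.Any as Any using (Any; here; there; any?)
open import Data.List.Relation.Unary.AllPairs using ([]; _∷_)
open import Data.List.Relation.Unary.Unique.Propositional using (Unique)
open import Data.Product using (∃; ∃-syntax; _×_; _,_; proj₁; proj₂)
open import Data.Sum as Sum using (_⊎_; inj₁; inj₂; swap; [_,_]′)
open import Data.Vec using ([]; _∷_; insertAt; removeAt; here; there) renaming (lookup to lookupᵥ)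
open import Data.Vec.Properties using
  (insertAt-lookup; insertAt-punchIn; insertAt-removeAt; lookup⇒[]=; []=⇒lookup)
open import Function.Base using (_∘_; id)
open import Function.Bundles using (_⇔_; mk⇔; Equivalence)
open import Relation.Binary.Construct.Closure.ReflexiveTransitive using (Star; ε; _◅_)
open import Relation.Binary.PropositionalEquality
  using (_≡_; _≢_; refl; sym; trans; cong; cong₂; subst; ≢-sym)
open import Relation.Nullary using (¬_; yes; no; contradiction)
open import Relation.Nullary.Decidable using (decidable-stable; ¬¬-excluded-middle)
open import Relation.Unary using (_∈_; _∖_)

open Equivalence using (to; from)

private variable
  n : ℕ

-- Finite sets

lookup-injective : ∀ {A : Set} {l : List A} → Unique l → ∀ i j → lookup l i ≡ lookup l j → i ≡ j
lookup-injective (_ ∷ _) zero    zero    _ = refl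
lookup-injective (p ∷ _) zero    (suc j) e = ⊥-elim (All.lookup p (∈-lookup j) e)
lookup-injective (p ∷ _) (suc i) zero    e = ⊥-elim (All.lookup p (∈-lookup i) (sym e))
lookup-injective (_ ∷ u) (suc i) (suc j) e = cong suc (lookup-injective u i j e)

∣p∪q∣≤∣p∣+∣q∣ : (p q : Subset n) → ∣ p ∪ q ∣ ≤ ∣ p ∣ + ∣ q ∣
∣p∪q∣≤∣p∣+∣q∣ []            []            = z≤n
∣p∪q∣≤∣p∣+∣q∣ (outside ∷ p) (outside ∷ q) = ∣p∪q∣≤∣p∣+∣q∣ p q
∣p∪q∣≤∣p∣+∣q∣ (outside ∷ p) (inside  ∷ q) =
  ≤-trans (s≤s (∣p∪q∣≤∣p∣+∣q∣ p q)) (≤-reflexive (sym (+-suc ∣ p ∣ ∣ q ∣)))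
∣p∪q∣≤∣p∣+∣q∣ (inside  ∷ p) (outside ∷ q) = s≤s (∣p∪q∣≤∣p∣+∣q∣ p q)
∣p∪q∣≤∣p∣+∣q∣ (inside  ∷ p) (inside  ∷ q) =
  s≤s (≤-trans (∣p∪q∣≤∣p∣+∣q∣ p q) (+-monoʳ-≤ ∣ p ∣ (n≤1+n ∣ q ∣)))

∣p∪⁅x⁆∣≤1+∣p∣ : (p : Subset n) (x : Fin n) → ∣ p ∪ ⁅ x ⁆ ∣ ≤ suc ∣ p ∣
∣p∪⁅x⁆∣≤1+∣p∣ p x = ≤-trans (∣p∪q∣≤∣p∣+∣q∣ p ⁅ x ⁆)
  (≤-reflexive (trans (cong (∣ p ∣ +_) (∣⁅x⁆∣≡1 x)) (+-comm ∣ p ∣ 1)))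

∣p∣≡∣p∩q∣+∣p∩∁q∣ : (p q : Subset n) → ∣ p ∣ ≡ ∣ p ∩ q ∣ + ∣ p ∩ ∁ q ∣
∣p∣≡∣p∩q∣+∣p∩∁q∣ []            []            = refl
∣p∣≡∣p∩q∣+∣p∩∁q∣ (outside ∷ p) (_       ∷ q) = ∣p∣≡∣p∩q∣+∣p∩∁q∣ p q
∣p∣≡∣p∩q∣+∣p∩∁q∣ (inside  ∷ p) (inside  ∷ q) = cong suc (∣p∣≡∣p∩q∣+∣p∩∁q∣ p q)
∣p∣≡∣p∩q∣+∣p∩∁q∣ (inside  ∷ p) (outside ∷ q) =
  trans (cong suc (∣p∣≡∣p∩q∣+∣p∩∁q∣ p q)) (sym (+-suc ∣ p ∩ q ∣ ∣ p ∩ ∁ q ∣))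

∣p∩q∣≡∣p∩q∩r∣+∣p∩q∩∁r∣ : (p q r : Subset n) →
  ∣ p ∩ q ∣ ≡ ∣ p ∩ (q ∩ r) ∣ + ∣ p ∩ (q ∩ ∁ r) ∣
∣p∩q∣≡∣p∩q∩r∣+∣p∩q∩∁r∣ p q r = trans (∣p∣≡∣p∩q∣+∣p∩∁q∣ (p ∩ q) r)
  (cong₂ (λ a b → ∣ a ∣ + ∣ b ∣) (∩-assoc p q r) (∩-assoc p q (∁ r)))

disjoint⇒∣p∣+∣q∣≤∣r∣ : {p q r : Subset n} → p ⊆ r → q ⊆ r → (∀ {x} → x ∈ₛ p → x ∉ₛ q) →
  ∣ p ∣ + ∣ q ∣ ≤ ∣ r ∣
disjoint⇒∣p∣+∣q∣≤∣r∣ {p = p} {q} {r} p⊆r q⊆r disj = begin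
  ∣ p ∣ + ∣ q ∣             ≤⟨ +-mono-≤
    (p⊆q⇒∣p∣≤∣q∣ (λ x∈p → x∈p∩q⁺ (p⊆r x∈p , x∈p)))
    (p⊆q⇒∣p∣≤∣q∣ (λ x∈q → x∈p∩q⁺ (q⊆r x∈q , x∉p⇒x∈∁p (λ x∈p → disj x∈p x∈q)))) ⟩
  ∣ r ∩ p ∣ + ∣ r ∩ ∁ p ∣   ≡⟨ ∣p∣≡∣p∩q∣+∣p∩∁q∣ r p ⟨
  ∣ r ∣                     ∎
  where open ≤-Reasoning

-- `Reach` comes without a decision procedure, so the sets it cuts out are obtained only under
-- double negation. Every use has a stable goal: a decidable inequality or `⊥`.
¬¬-comprehension : (P : Fin n → Set) → ¬ ¬ (∃[ p ] (∀ x → x ∈ₛ p ⇔ P x))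
¬¬-comprehension {zero}  P k = k ([] , λ ())
¬¬-comprehension {suc n} P k =
  ¬¬-comprehension (P ∘ suc) λ (p , p⇔) → ¬¬-excluded-middle λ where
    (yes P0) → k (inside ∷ p , λ where
      zero    → mk⇔ (λ _ → P0) (λ _ → here)
      (suc x) → mk⇔ (to (p⇔ x) ∘ drop-there) (there ∘ from (p⇔ x)))
    (no ¬P0) → k (outside ∷ p , λ where
      zero    → mk⇔ (λ ()) (⊥-elim ∘ ¬P0)
      (suc x) → mk⇔ (to (p⇔ x) ∘ drop-there) (there ∘ from (p⇔ x)))

-- Induced paths and cycles

-- Repetitions are not excluded: for adjacent `a` and `b` the list `a ∷ b ∷ a ∷ []` qualifies.
-- Distinctness is derived for arcs in `arc-unique`.
data InducedPath (G : Graph n) : List (Fin n) → Set where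
  end  : ∀ {x} → InducedPath G [ x ]
  cons : ∀ {x y l} → Adj G x y → All (¬_ ∘ Adj G x) l →
         InducedPath G (y ∷ l) → InducedPath G (x ∷ y ∷ l)

inducedPath-adj : (G : Graph n) → ∀ {l} → InducedPath G l → ∀ i j →
  Adj G (lookup l i) (lookup l j) ⇔ (toℕ j ≡ suc (toℕ i) ⊎ toℕ i ≡ suc (toℕ j))
inducedPath-adj G {_ ∷ _} _           zero          zero          =
  mk⇔ (⊥-elim ∘ Graph.irrefl G) λ { (inj₁ ()) ; (inj₂ ()) }
inducedPath-adj G (cons xy _ _)       zero          (suc zero)    =
  mk⇔ (λ _ → inj₁ refl) (λ _ → xy)
inducedPath-adj G (cons _ ¬xl _)      zero          (suc (suc j)) =
  mk⇔ (⊥-elim ∘ All.lookup ¬xl (∈-lookup j)) λ { (inj₁ ()) ; (inj₂ ()) }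
inducedPath-adj G (cons xy _ _)       (suc zero)    zero          =
  mk⇔ (λ _ → inj₂ refl) (λ _ → Graph.sym G xy)
inducedPath-adj G (cons _ ¬xl _)      (suc (suc i)) zero          =
  mk⇔ (⊥-elim ∘ All.lookup ¬xl (∈-lookup i) ∘ Graph.sym G) λ { (inj₁ ()) ; (inj₂ ()) }
inducedPath-adj G (cons _ _ p)        (suc i)       (suc j)       = mk⇔
  ([ inj₁ ∘ cong suc , inj₂ ∘ cong suc ]′ ∘ to (inducedPath-adj G p i j))
  (from (inducedPath-adj G p i j) ∘ [ inj₁ ∘ suc-injective , inj₂ ∘ suc-injective ]′)

-- Arcs outside N[v], chordality and reachability

module Neighbourhood (G : Graph n) (v : Fin n) where

  Far : Fin n → Set
  Far x = x ≢ v × ¬ Adj G v x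

  position : ∀ x → x ≡ v ⊎ Adj G v x ⊎ Far x
  position x with x ≟ v | adj? G v x
  ... | yes x≡v | _      = inj₁ x≡v
  ... | no  _   | yes vx = inj₂ (inj₁ vx)
  ... | no  x≢v | no ¬vx = inj₂ (inj₂ (x≢v , ¬vx))

  adj⇒≢ : ∀ {x} → Adj G v x → x ≢ v
  adj⇒≢ vx refl = Graph.irrefl G vx

  -- An induced path to the neighbour y of v whose other vertices lie outside N[v].
  data Arc (y : Fin n) : List (Fin n) → Set where
    end  : Adj G v y → Arc y [ y ]
    cons : ∀ {x z l} → Far x → Adj G x z → All (¬_ ∘ Adj G x) l →
           Arc y (z ∷ l) → Arc y (x ∷ z ∷ l)

  arc-inducedPath : ∀ {y l} → Arc y l → InducedPath G l
  arc-inducedPath (end _)           = end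
  arc-inducedPath (cons _ xz ¬xl a) = cons xz ¬xl (arc-inducedPath a)

  arc-adj : ∀ {y l} → Arc y l → ∀ i → Adj G v (lookup l i) ⇔ suc (toℕ i) ≡ length l
  arc-adj (end vy)                  zero    = mk⇔ (λ _ → refl) (λ _ → vy)
  arc-adj (cons (_ , ¬vx) _ _ _)    zero    = mk⇔ (⊥-elim ∘ ¬vx) λ ()
  arc-adj (cons _ _ _ a)            (suc i) =
    mk⇔ (cong suc ∘ to (arc-adj a i)) (from (arc-adj a i) ∘ suc-injective)

  arc-≢v : ∀ {y l} → Arc y l → All (v ≢_) l
  arc-≢v (end vy)               = ≢-sym (adj⇒≢ vy) ∷ []
  arc-≢v (cons (x≢v , _) _ _ a) = ≢-sym x≢v ∷ arc-≢v a

  arc-member : ∀ {x y z l} → Arc y (z ∷ l) → x ∈ₗ z ∷ l → x ≡ y ⊎ Any (Adj G x) l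
  arc-member (end _)         (here refl) = inj₁ refl
  arc-member (cons _ xz _ _) (here refl) = inj₂ (here xz)
  arc-member (cons _ _ _ a)  (there x∈l) with arc-member a x∈l
  ... | inj₁ x≡y = inj₁ x≡y
  ... | inj₂ xl  = inj₂ (there xl)

  -- By `arc-member`, a vertex of the arc other than its end is adjacent to its successor, which
  -- lies in `l`. So having no neighbour in `l` keeps `x` off the arc.
  arc-fresh : ∀ {x y z l} → Arc y (z ∷ l) → x ≢ y → Adj G x z → All (¬_ ∘ Adj G x) l →
    All (x ≢_) (z ∷ l)
  arc-fresh a x≢y xz ¬xl = All.tabulate λ where
    x∈ refl → [ x≢y , All¬⇒¬Any ¬xl ]′ (arc-member a x∈)

  arc-unique : ∀ {y l} → Arc y l → Unique l
  arc-unique (end _) = [] ∷ []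
  arc-unique {y} (cons (_ , ¬vx) xz ¬xl a) =
    arc-fresh a (λ { refl → ¬vx (arc-end a) }) xz ¬xl ∷ arc-unique a
    where
    arc-end : ∀ {l} → Arc y l → Adj G v y
    arc-end (end vy)       = vy
    arc-end (cons _ _ _ a) = arc-end a

  -- Cuts an arc at the last neighbour of x, so that x extends it to an induced path.
  arc-truncate : ∀ {x y l} → Arc y l → Any (Adj G x) l →
    ∃[ z ] ∃[ l′ ] (Arc y (z ∷ l′) × Adj G x z × All (¬_ ∘ Adj G x) l′)
  arc-truncate a@(end _)            (here xz) = _ , _ , a , xz , []
  arc-truncate {x} a@(cons {l = l} _ _ _ a′) xl with any? (adj? G x) (_ ∷ l)
  ... | yes xl′ = arc-truncate a′ xl′
  ... | no  ¬xl = _ , _ , a , [ id , ⊥-elim ∘ ¬xl ]′ (Any.toSum xl) , ¬Any⇒All¬ _ ¬xl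

  -- The arc meets N(v) only in its last vertex `y`, and `x` sees only its first vertex `z`, so `v`
  -- and `x` close it to a chordless cycle. The explicit `w` gives the arc two vertices and the
  -- cycle at least four.
  arc-cycle : ∀ {x y z w l} → Adj G v x → x ≢ y → Adj G x z → All (¬_ ∘ Adj G x) (w ∷ l) →
    Arc y (z ∷ w ∷ l) → InducedCycle G (4 + length l)
  arc-cycle {x} {y} {z} {w} {l} vx x≢y xz ¬xl a = lookup c , injective , adj
    where
    c = v ∷ x ∷ z ∷ w ∷ l
    k = 4 + length l

    injective : ∀ {i j} → lookup c i ≡ lookup c j → i ≡ j
    injective = lookup-injective
      ((≢-sym (adj⇒≢ vx) ∷ arc-≢v a) ∷ arc-fresh a x≢y xz ¬xl ∷ arc-unique a) _ _

    adj-zero : ∀ j → Adj G v (lookup c j) ⇔ CycleAdj k zero j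
    adj-zero zero          = mk⇔ (⊥-elim ∘ Graph.irrefl G)
      λ { (inj₁ (inj₁ ())) ; (inj₁ (inj₂ (() , _))) ; (inj₂ (inj₁ ())) ; (inj₂ (inj₂ (() , _))) }
    adj-zero (suc zero)    = mk⇔ (λ _ → inj₁ (inj₁ refl)) (λ _ → vx)
    -- The closing edge joins `v` to the last vertex of the arc; the entries `v` and `x` before the
    -- arc shift indices by 2.
    adj-zero (suc (suc j)) = mk⇔
      (λ vj → inj₂ (inj₂ (cong (2 +_) (to (arc-adj a j) vj) , refl)))
      λ { (inj₁ (inj₁ ())) ; (inj₁ (inj₂ (() , _))) ; (inj₂ (inj₁ ()))
        ; (inj₂ (inj₂ (e , _))) → from (arc-adj a j) (suc-injective (suc-injective e)) }

    adj : ∀ i j → Adj G (lookup c i) (lookup c j) ⇔ CycleAdj k i j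
    adj zero    j       = adj-zero j
    adj (suc i) zero    = mk⇔
      (swap ∘ to (adj-zero (suc i)) ∘ Graph.sym G) (Graph.sym G ∘ from (adj-zero (suc i)) ∘ swap)
    adj (suc i) (suc j) = mk⇔
      ([ inj₁ ∘ inj₁ ∘ cong suc , inj₂ ∘ inj₁ ∘ cong suc ]′ ∘ to (path i j))
      λ { (inj₁ (inj₁ e)) → from (path i j) (inj₁ (suc-injective e))
        ; (inj₁ (inj₂ (_ , ())))
        ; (inj₂ (inj₁ e)) → from (path i j) (inj₂ (suc-injective e))
        ; (inj₂ (inj₂ (_ , ()))) }
      where
      path = inducedPath-adj G (cons xz ¬xl (arc-inducedPath a))

  -- After truncation `x` sees only the first vertex of the arc. Either that vertex is `y`, or
  -- `arc-cycle` contradicts chordality.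
  chordal⇒arc-adj : Chordal G → ∀ {x y l} → Adj G v x → x ≢ y → Arc y l →
    Any (Adj G x) l → Adj G x y
  chordal⇒arc-adj chordal {x} {y} vx x≢y a xl with arc-truncate a xl
  ... | _ , []     , end _ , xy , _   = xy
  ... | _ , w ∷ l′ , a′    , xz , ¬xl =
    ⊥-elim (chordal _ (s≤s (s≤s (s≤s (s≤s z≤n)))) (arc-cycle vx x≢y xz ¬xl a′))

  -- The vertices of G - N[v] in components attached to B.
  data Reach (B : Subset n) : Fin n → Set where
    attach : ∀ {b x} → b ∈ₛ B → Adj G b x → Far x → Reach B x
    extend : ∀ {x y} → Reach B x → Adj G x y → Far y → Reach B y

  reach⇒far : ∀ {B x} → Reach B x → Far x
  reach⇒far (attach _ _ far) = far
  reach⇒far (extend _ _ far)  = far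

  -- A new vertex may have several neighbours on the arc built so far; cutting the arc at the last
  -- of them before prepending keeps it chordless.
  reach⇒arc : ∀ {B x} → (∀ {b} → b ∈ₛ B → Adj G v b) → Reach B x →
    ∃[ b ] (b ∈ₛ B × ∃[ l ] Arc b (x ∷ l))
  reach⇒arc B⊆N (attach b∈B bx far) =
    _ , b∈B , _ , cons far (Graph.sym G bx) [] (end (B⊆N b∈B))
  reach⇒arc B⊆N (extend r xy far) with reach⇒arc B⊆N r
  ... | b , b∈B , _ , a with arc-truncate a (here (Graph.sym G xy))
  ...   | _ , _ , a′ , yz , ¬yl = b , b∈B , _ , cons far yz ¬yl a′

  -- This lets `B` take over the domination of those neighbours of `v` whose dominators are
  -- discarded in `exchange`.
  reach⇒adj : Chordal G → ∀ {B x y} → (∀ {b} → b ∈ₛ B → Adj G v b) → Reach B y →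
    Adj G v x → Adj G x y → x ∈ₛ B ⊎ (∃[ b ] (b ∈ₛ B × Adj G x b))
  reach⇒adj chordal {x = x} B⊆N r vx xy with reach⇒arc B⊆N r
  ... | b , b∈B , _ , a with x ≟ b
  ...   | yes refl = inj₁ b∈B
  ...   | no  x≢b  = inj₂ (b , b∈B , chordal⇒arc-adj chordal vx x≢b a (here xy))

  -- The witness is the first neighbour of `v` on the walk: a walk cannot step from a far vertex
  -- straight to `v`.
  reach-from-neighbour : ∀ {x} → Star (Adj G) x v → Far x → ∃[ w ] (Adj G v w × Reach ⁅ w ⁆ x)
  reach-from-neighbour ε (v≢v , _) = contradiction refl v≢v
  reach-from-neighbour (_◅_ {j = y} xy y⟶v) far with position y
  ... | inj₁ refl        = contradiction (Graph.sym G xy) (proj₂ far)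
  ... | inj₂ (inj₁ vy)   = y , vy , attach (x∈⁅x⁆ y) (Graph.sym G xy) far
  ... | inj₂ (inj₂ far′) with reach-from-neighbour y⟶v far′
  ...   | w , vw , r = w , vw , extend r (Graph.sym G xy) far

-- Dominating sets

-- For `D` avoiding `v` this is domination of `G - v`, stated on subsets of `G` to avoid renumbering
-- vertices.
DominatesExcept : Graph n → Fin n → Subset n → Set
DominatesExcept G v D = ∀ x → x ≢ v → x ∈ₛ D ⊎ (∃[ y ] (y ∈ₛ D × Adj G x y))

module Domination (G : Graph n) (v : Fin n) where
  open Neighbourhood G v

  γ≤ : ∀ {S} → Dominating G S → γ G ≤ ∣ S ∣
  γ≤ = proj₂ (γ-minimum G) _

  dominating⇒mds : ∀ {S} → Dominating G S → ∣ S ∣ ≤ γ G → IsMDS G S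
  dominating⇒mds dom ≤γ = dom , ≤-antisym ≤γ (γ≤ dom)

  dominating-∪ : ∀ {D x} → DominatesExcept G v D → v ≡ x ⊎ Adj G v x → Dominating G (D ∪ ⁅ x ⁆)
  dominating-∪ {D} {x} dom vx y with y ≟ v
  ... | yes refl = [ (λ { refl → inj₁ (q⊆p∪q D ⁅ y ⁆ (x∈⁅x⁆ y)) })
                   , (λ yx → inj₂ (x , q⊆p∪q D ⁅ x ⁆ (x∈⁅x⁆ x) , yx)) ]′ vx
  ... | no  y≢v  = [ (λ y∈D → inj₁ (p⊆p∪q ⁅ x ⁆ y∈D))
                   , (λ (z , z∈D , yz) → inj₂ (z , p⊆p∪q ⁅ x ⁆ z∈D , yz)) ]′ (dom y y≢v)

  v∉∪ : ∀ {D x} → v ∉ₛ D → Adj G v x → v ∉ₛ D ∪ ⁅ x ⁆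
  v∉∪ {D} v∉D vx v∈ = [ v∉D , (λ v∈x → adj⇒≢ vx (sym (x∈⁅y⁆⇒x≡y _ v∈x))) ]′ (x∈p∪q⁻ D _ v∈)

  core⇒γ<∣S∣ : v ∈ core G → ∀ {S} → Dominating G S → v ∉ₛ S → γ G < ∣ S ∣
  core⇒γ<∣S∣ v∈core dom v∉S = ≰⇒> λ ≤γ → v∉S (v∈core _ (dominating⇒mds dom ≤γ))

  -- The set `T` below dominates `G` and avoids `v`, so `minimal` applies to it, and the common part
  -- `D ∩ ∁ Q` cancels.
  exchange : Chordal G → ∀ {S D} B Q →
    (∀ {T} → Dominating G T → v ∉ₛ T → ∣ D ∣ < ∣ T ∣) →
    Dominating G S → DominatesExcept G v D → (∀ {d} → d ∈ₛ D → Far d) →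
    Nonempty B → (∀ {b} → b ∈ₛ B → Adj G v b) →
    (∀ {r} → r ∈ₛ Q → Reach B r) →
    (∀ {r s} → r ∈ₛ Q → Adj G r s → Far s → s ∈ₛ Q) →
    (∀ {r s} → r ∈ₛ Q → s ∈ₛ S → Adj G v s → Adj G r s → s ∈ₛ B) →
    ∣ D ∩ Q ∣ < ∣ S ∩ Q ∣ + ∣ B ∣
  exchange chordal {S} {D} B Q minimal S-dom D-dom D-far (b₀ , b₀∈B) B⊆N Q-reach Q-closed S-B =
    +-cancelˡ-< ∣ D ∩ ∁ Q ∣ _ _ (begin-strict
      ∣ D ∩ ∁ Q ∣ + ∣ D ∩ Q ∣            ≡⟨ +-comm ∣ D ∩ ∁ Q ∣ _ ⟩
      ∣ D ∩ Q ∣ + ∣ D ∩ ∁ Q ∣            ≡⟨ ∣p∣≡∣p∩q∣+∣p∩∁q∣ D Q ⟨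
      ∣ D ∣                              <⟨ minimal T-dom v∉T ⟩
      ∣ T ∣                              ≤⟨ ∣p∪q∣≤∣p∣+∣q∣ (D ∩ ∁ Q) _ ⟩
      ∣ D ∩ ∁ Q ∣ + ∣ (S ∩ Q) ∪ B ∣      ≤⟨ +-monoʳ-≤ ∣ D ∩ ∁ Q ∣ (∣p∪q∣≤∣p∣+∣q∣ (S ∩ Q) B) ⟩
      ∣ D ∩ ∁ Q ∣ + (∣ S ∩ Q ∣ + ∣ B ∣)  ∎)
    where
    open ≤-Reasoning
    T = (D ∩ ∁ Q) ∪ ((S ∩ Q) ∪ B)

    fromD : ∀ {x} → x ∈ₛ D → x ∉ₛ Q → x ∈ₛ T
    fromD x∈D x∉Q = x∈p∪q⁺ (inj₁ (x∈p∩q⁺ (x∈D , x∉p⇒x∈∁p x∉Q)))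

    fromS : ∀ {x} → x ∈ₛ S → x ∈ₛ Q → x ∈ₛ T
    fromS x∈S x∈Q = x∈p∪q⁺ (inj₂ (x∈p∪q⁺ (inj₁ (x∈p∩q⁺ (x∈S , x∈Q)))))

    fromB : ∀ {x} → x ∈ₛ B → x ∈ₛ T
    fromB x∈B = x∈p∪q⁺ (inj₂ (x∈p∪q⁺ (inj₂ x∈B)))

    v∉T : v ∉ₛ T
    v∉T v∈T with x∈p∪q⁻ (D ∩ ∁ Q) _ v∈T
    ... | inj₁ v∈D = proj₁ (D-far (proj₁ (x∈p∩q⁻ D _ v∈D))) refl
    ... | inj₂ v∈SB with x∈p∪q⁻ (S ∩ Q) B v∈SB
    ...   | inj₁ v∈SQ = proj₁ (reach⇒far (Q-reach (proj₂ (x∈p∩q⁻ S Q v∈SQ)))) refl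
    ...   | inj₂ v∈B  = Graph.irrefl G (B⊆N v∈B)

    T-dom-near : ∀ {x} → Adj G v x → x ∈ₛ T ⊎ (∃[ y ] (y ∈ₛ T × Adj G x y))
    T-dom-near {x} vx with D-dom x (adj⇒≢ vx)
    ... | inj₁ x∈D = contradiction vx (proj₂ (D-far x∈D))
    ... | inj₂ (d , d∈D , xd) with d ∈? Q
    ...   | no  d∉Q = inj₂ (d , fromD d∈D d∉Q , xd)
    ...   | yes d∈Q with reach⇒adj chordal B⊆N (Q-reach d∈Q) vx xd
    ...     | inj₁ x∈B            = inj₁ (fromB x∈B)
    ...     | inj₂ (b , b∈B , xb) = inj₂ (b , fromB b∈B , xb)

    T-dom-Q : ∀ {x} → x ∈ₛ Q → x ∈ₛ T ⊎ (∃[ y ] (y ∈ₛ T × Adj G x y))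
    T-dom-Q {x} x∈Q with S-dom x
    ... | inj₁ x∈S = inj₁ (fromS x∈S x∈Q)
    ... | inj₂ (s , s∈S , xs) with position s
    ...   | inj₁ refl       = contradiction (Graph.sym G xs) (proj₂ (reach⇒far (Q-reach x∈Q)))
    ...   | inj₂ (inj₁ vs)  = inj₂ (s , fromB (S-B x∈Q s∈S vs xs) , xs)
    ...   | inj₂ (inj₂ far) = inj₂ (s , fromS s∈S (Q-closed x∈Q xs far) , xs)

    T-dom-far : ∀ {x} → Far x → x ∉ₛ Q → x ∈ₛ T ⊎ (∃[ y ] (y ∈ₛ T × Adj G x y))
    T-dom-far {x} far x∉Q with D-dom x (proj₁ far)
    ... | inj₁ x∈D            = inj₁ (fromD x∈D x∉Q)
    -- The dominator `d` is kept in `T`: were it in `Q`, closure under far neighbours would put `x`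
    -- in `Q`.
    ... | inj₂ (d , d∈D , xd) =
      inj₂ (d , fromD d∈D (λ d∈Q → x∉Q (Q-closed d∈Q (Graph.sym G xd) far)) , xd)

    T-dom : Dominating G T
    T-dom x with position x | x ∈? Q
    ... | inj₁ refl       | _       = inj₂ (b₀ , fromB b₀∈B , B⊆N b₀∈B)
    ... | inj₂ (inj₁ vx)  | _       = T-dom-near vx
    ... | inj₂ (inj₂ far) | yes x∈Q = T-dom-Q x∈Q
    ... | inj₂ (inj₂ far) | no  x∉Q = T-dom-far far x∉Q

  -- Induction on the candidates `ws`: `exchange` with a singleton `B` settles the components in `Y`
  -- attached to `w`, and the remaining candidates cover the rest. As no vertex of `Y` has a
  -- neighbour in S ∩ N(v), the condition tying `S` to `B` holds vacuously.
  exchange-all : Chordal G → ∀ {S D} →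
    (∀ {T} → Dominating G T → v ∉ₛ T → ∣ D ∣ < ∣ T ∣) →
    Dominating G S → DominatesExcept G v D → (∀ {d} → d ∈ₛ D → Far d) →
    ∀ ws Y →
    (∀ {r} → r ∈ₛ Y → Any (λ w → Adj G v w × Reach ⁅ w ⁆ r) ws) →
    (∀ {r s} → r ∈ₛ Y → Adj G r s → Far s → s ∈ₛ Y) →
    (∀ {r s} → r ∈ₛ Y → s ∈ₛ S → Adj G v s → ¬ Adj G r s) →
    ∣ D ∩ Y ∣ ≤ ∣ S ∩ Y ∣
  exchange-all chordal {S} {D} minimal S-dom D-dom D-far = go
    where
    go : ∀ ws Y →
      (∀ {r} → r ∈ₛ Y → Any (λ w → Adj G v w × Reach ⁅ w ⁆ r) ws) →
      (∀ {r s} → r ∈ₛ Y → Adj G r s → Far s → s ∈ₛ Y) →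
      (∀ {r s} → r ∈ₛ Y → s ∈ₛ S → Adj G v s → ¬ Adj G r s) →
      ∣ D ∩ Y ∣ ≤ ∣ S ∩ Y ∣
    go [] Y cover _ _ =
      p⊆q⇒∣p∣≤∣q∣ {q = S ∩ Y} λ x∈ → contradiction (cover (proj₂ (x∈p∩q⁻ D Y x∈))) λ ()
    go (w ∷ ws) Y cover closed apart with adj? G v w
    ... | no ¬vw =
      go ws Y (λ r∈Y → [ ⊥-elim ∘ ¬vw ∘ proj₁ , id ]′ (Any.toSum (cover r∈Y))) closed apart
    -- The goal is decidable, so the set `U` of vertices reached from `w` may be assumed to exist.
    ... | yes vw = decidable-stable (_ ≤? _) λ ≰ →
      ¬¬-comprehension (Reach ⁅ w ⁆) λ (U , U⇔) → ≰ (split U U⇔)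
      where
      split : ∀ U → (∀ x → x ∈ₛ U ⇔ Reach ⁅ w ⁆ x) → ∣ D ∩ Y ∣ ≤ ∣ S ∩ Y ∣
      split U U⇔ = begin
        ∣ D ∩ Y ∣                              ≡⟨ ∣p∩q∣≡∣p∩q∩r∣+∣p∩q∩∁r∣ D Y U ⟩
        ∣ D ∩ (Y ∩ U) ∣ + ∣ D ∩ (Y ∩ ∁ U) ∣    ≤⟨ +-mono-≤ D≤S-in
          (go ws (Y ∩ ∁ U) cover′ closed′ (apart ∘ Y∩∁U⊆Y)) ⟩
        ∣ S ∩ (Y ∩ U) ∣ + ∣ S ∩ (Y ∩ ∁ U) ∣    ≡⟨ ∣p∩q∣≡∣p∩q∩r∣+∣p∩q∩∁r∣ S Y U ⟨
        ∣ S ∩ Y ∣                              ∎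
        where
        open ≤-Reasoning
        Y∩U⊆Y : Y ∩ U ⊆ Y
        Y∩U⊆Y = p∩q⊆p Y U
        Y∩∁U⊆Y : Y ∩ ∁ U ⊆ Y
        Y∩∁U⊆Y = p∩q⊆p Y (∁ U)

        reach : ∀ {r} → r ∈ₛ Y ∩ U → Reach ⁅ w ⁆ r
        reach r∈ = to (U⇔ _) (proj₂ (x∈p∩q⁻ Y U r∈))

        D≤S-in : ∣ D ∩ (Y ∩ U) ∣ ≤ ∣ S ∩ (Y ∩ U) ∣
        -- The strictness in `exchange` pays for the one element of the singleton.
        D≤S-in = ≤-pred (≤-trans
          (exchange chordal {S} {D} ⁅ w ⁆ (Y ∩ U) minimal S-dom D-dom D-far (w , x∈⁅x⁆ w)
            (λ b∈ → subst (Adj G v) (sym (x∈⁅y⁆⇒x≡y w b∈)) vw)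
            reach
            (λ r∈ rs far → x∈p∩q⁺
              (closed (Y∩U⊆Y r∈) rs far , from (U⇔ _) (extend (reach r∈) rs far)))
            (λ r∈ s∈S vs rs → contradiction rs (apart (Y∩U⊆Y r∈) s∈S vs)))
          (≤-reflexive (trans (cong (∣ S ∩ (Y ∩ U) ∣ +_) (∣⁅x⁆∣≡1 w)) (+-comm _ 1))))

        cover′ : ∀ {r} → r ∈ₛ Y ∩ ∁ U → Any (λ w → Adj G v w × Reach ⁅ w ⁆ r) ws
        cover′ r∈ with cover (Y∩∁U⊆Y r∈)
        ... | here (_ , r) = contradiction (from (U⇔ _) r) (x∈∁p⇒x∉p (proj₂ (x∈p∩q⁻ Y _ r∈)))
        ... | there any    = any

        far-Y : ∀ {r} → r ∈ₛ Y → Far r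
        far-Y r∈Y = reach⇒far (proj₂ (proj₂ (Any.satisfied (cover r∈Y))))

        closed′ : ∀ {r s} → r ∈ₛ Y ∩ ∁ U → Adj G r s → Far s → s ∈ₛ Y ∩ ∁ U
        -- If `s` were reached from `w`, its far neighbour `r` would be reached as well.
        closed′ r∈ rs far = x∈p∩q⁺ (closed (Y∩∁U⊆Y r∈) rs far , x∉p⇒x∈∁p λ s∈U →
          x∈∁p⇒x∉p (proj₂ (x∈p∩q⁻ Y _ r∈))
            (from (U⇔ _) (extend (to (U⇔ _) s∈U) (Graph.sym G rs) (far-Y (Y∩∁U⊆Y r∈)))))

  core⇒γ<∣D∣ : Connected G → Chordal G → ∃ (Adj G v) → v ∈ core G →
    ∀ {D} → v ∉ₛ D → DominatesExcept G v D → γ G < ∣ D ∣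
  core⇒γ<∣D∣ connected chordal (w , vw) v∈core {D} v∉D D-dom = ≰⇒> impossible
    where
    impossible : ¬ ∣ D ∣ ≤ γ G
    impossible ∣D∣≤γ with γ-minimum G
    ... | (S , S-dom , ∣S∣≡γ) , _ =
      -- `B` is S ∩ N(v), `T` the union of the components attached to `B`, and `Y` that of the
      -- others.
      ¬¬-comprehension (λ x → x ∈ₛ S × Adj G v x) λ (B , B⇔) →
      ¬¬-comprehension (Reach B) λ (T , T⇔) →
      ¬¬-comprehension (λ x → Far x × ¬ Reach B x) λ (Y , Y⇔) →
      count B B⇔ T T⇔ Y Y⇔
      where
      v∈S : v ∈ₛ S
      v∈S = v∈core S (S-dom , ∣S∣≡γ)

      minimal : ∀ {T} → Dominating G T → v ∉ₛ T → ∣ D ∣ < ∣ T ∣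
      minimal dom v∉T = ≤-<-trans ∣D∣≤γ (core⇒γ<∣S∣ v∈core dom v∉T)

      γ≤∣D∣ : γ G ≤ ∣ D ∣
      -- `D` with the neighbour `w` of `v` dominates `G` and avoids `v`, so it has more than γ(G)
      -- vertices.
      γ≤∣D∣ = ≤-pred (≤-trans
        (core⇒γ<∣S∣ v∈core (dominating-∪ D-dom (inj₂ vw)) (v∉∪ v∉D vw)) (∣p∪⁅x⁆∣≤1+∣p∣ D w))

      D-far : ∀ {d} → d ∈ₛ D → Far d
      -- A neighbour of `v` in `D` would make `D` dominating, and `minimal` would compare `D` with
      -- itself.
      D-far {d} d∈D = (λ { refl → v∉D d∈D }) , λ vd → <-irrefl refl (minimal (dom vd) v∉D)
        where
        dom : Adj G v d → Dominating G D
        dom vd x with x ≟ v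
        ... | yes refl = inj₂ (d , d∈D , vd)
        ... | no  x≢v  = D-dom x x≢v

      count : ∀ B → (∀ x → x ∈ₛ B ⇔ (x ∈ₛ S × Adj G v x)) →
              ∀ T → (∀ x → x ∈ₛ T ⇔ Reach B x) →
              ∀ Y → (∀ x → x ∈ₛ Y ⇔ (Far x × ¬ Reach B x)) → ⊥
      count B B⇔ T T⇔ Y Y⇔ = <⇒≱ (begin-strict
        ∣ D ∣                                            ≤⟨ D-split ⟩
        ∣ D ∩ T ∣ + ∣ D ∩ Y ∣                            ≤⟨ +-mono-≤ D≤S-on-T D≤S-on-Y ⟩
        (∣ S ∩ T ∣ + ∣ B ∣) + ∣ S ∩ Y ∣                  <⟨ S-split ⟩
        ∣ S ∣                                            ≡⟨ ∣S∣≡γ ⟩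
        γ G                                              ∎) γ≤∣D∣
        where
        open ≤-Reasoning

        T-reach : ∀ {r} → r ∈ₛ T → Reach B r
        T-reach = to (T⇔ _)

        B⊆N : ∀ {b} → b ∈ₛ B → Adj G v b
        B⊆N = proj₂ ∘ to (B⇔ _)

        D≤S-on-T : ∣ D ∩ T ∣ ≤ ∣ S ∩ T ∣ + ∣ B ∣
        -- In `exchange` it is a vertex of `B` that dominates `v`. If `B` is empty, nothing is
        -- reached and `T` is empty too.
        D≤S-on-T with nonempty? B
        ... | yes B≢∅ = <⇒≤ (exchange chordal {S} {D} B T minimal S-dom D-dom D-far B≢∅ B⊆N
          T-reach (λ r∈T rs far → from (T⇔ _) (extend (T-reach r∈T) rs far))
          (λ _ s∈S vs _ → from (B⇔ _) (s∈S , vs)))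
        ... | no  B≡∅ = ≤-trans
          (p⊆q⇒∣p∣≤∣q∣ {q = S ∩ T} λ x∈ → ⊥-elim (unreachable (T-reach (proj₂ (x∈p∩q⁻ D T x∈)))))
          (m≤m+n _ _)
          where
          unreachable : ∀ {x} → ¬ Reach B x
          unreachable (attach b∈B _ _) = B≡∅ (_ , b∈B)
          unreachable (extend r _ _)    = unreachable r

        D≤S-on-Y : ∣ D ∩ Y ∣ ≤ ∣ S ∩ Y ∣
        D≤S-on-Y = exchange-all chordal {S} {D} minimal S-dom D-dom D-far (allFin _) Y
          (λ {r} r∈Y → let w , vw , rw = reach-from-neighbour (connected r v) (proj₁ (to (Y⇔ r) r∈Y))
                       in lose (∈-allFin w) (vw , rw))
          (λ r∈Y rs far → from (Y⇔ _) (far , λ reach →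
            proj₂ (to (Y⇔ _) r∈Y) (extend reach (Graph.sym G rs) (proj₁ (to (Y⇔ _) r∈Y)))))
          (λ r∈Y s∈S vs rs → proj₂ (to (Y⇔ _) r∈Y)
            (attach (from (B⇔ _) (s∈S , vs)) (Graph.sym G rs) (proj₁ (to (Y⇔ _) r∈Y))))

        D-split : ∣ D ∣ ≤ ∣ D ∩ T ∣ + ∣ D ∩ Y ∣
        D-split = ≤-trans (≤-reflexive (∣p∣≡∣p∩q∣+∣p∩∁q∣ D T))
          (+-monoʳ-≤ ∣ D ∩ T ∣ (p⊆q⇒∣p∣≤∣q∣ λ x∈ → let x∈D , x∈∁T = x∈p∩q⁻ D (∁ T) x∈ in
            x∈p∩q⁺ (x∈D , from (Y⇔ _) (D-far x∈D , x∈∁p⇒x∉p x∈∁T ∘ from (T⇔ _)))))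

        S-split : ∣ S ∩ T ∣ + ∣ B ∣ + ∣ S ∩ Y ∣ < ∣ S ∣
        S-split = begin-strict
          ∣ S ∩ T ∣ + ∣ B ∣ + ∣ S ∩ Y ∣    ≤⟨ +-mono-≤
            (disjoint⇒∣p∣+∣q∣≤∣r∣
              (λ x∈ → let x∈S , x∈T = x∈p∩q⁻ S T x∈ in
                x∈S-v∩∁Y x∈S (proj₁ (reach⇒far (T-reach x∈T)))
                  (λ x∈Y → proj₂ (to (Y⇔ _) x∈Y) (T-reach x∈T)))
              (λ x∈B → x∈S-v∩∁Y (proj₁ (to (B⇔ _) x∈B)) (adj⇒≢ (B⊆N x∈B))
                (λ x∈Y → proj₂ (proj₁ (to (Y⇔ _) x∈Y)) (B⊆N x∈B)))
              (λ x∈ x∈B → proj₂ (reach⇒far (T-reach (proj₂ (x∈p∩q⁻ S T x∈)))) (B⊆N x∈B)))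
            (p⊆q⇒∣p∣≤∣q∣ λ x∈ → let x∈S , x∈Y = x∈p∩q⁻ S Y x∈ in
              x∈p∩q⁺ (x∈p∧x≢y⇒x∈p-y x∈S (proj₁ (proj₁ (to (Y⇔ _) x∈Y))) , x∈Y)) ⟩
          ∣ (S -ₛ v) ∩ ∁ Y ∣ + ∣ (S -ₛ v) ∩ Y ∣  ≡⟨ +-comm ∣ (S -ₛ v) ∩ ∁ Y ∣ _ ⟩
          ∣ (S -ₛ v) ∩ Y ∣ + ∣ (S -ₛ v) ∩ ∁ Y ∣  ≡⟨ ∣p∣≡∣p∩q∣+∣p∩∁q∣ (S -ₛ v) Y ⟨
          -- The strictness of the whole count arises here: `v` lies in `S` but in none of `T`, `B`
          -- and `Y`.
          ∣ S -ₛ v ∣                       <⟨ x∈p⇒∣p-x∣<∣p∣ v∈S ⟩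
          ∣ S ∣                            ∎
          where
          x∈S-v∩∁Y : ∀ {x} → x ∈ₛ S → x ≢ v → x ∉ₛ Y → x ∈ₛ (S -ₛ v) ∩ ∁ Y
          x∈S-v∩∁Y x∈S x≢v x∉Y = x∈p∩q⁺ (x∈p∧x≢y⇒x∈p-y x∈S x≢v , x∉p⇒x∈∁p x∉Y)

-- Vertex deletion

insertAt-outside-∣∣ : (p : Subset n) (v : Fin (suc n)) → ∣ insertAt p v outside ∣ ≡ ∣ p ∣
insertAt-outside-∣∣ p             zero    = refl
insertAt-outside-∣∣ (outside ∷ p) (suc v) = insertAt-outside-∣∣ p v
insertAt-outside-∣∣ (inside  ∷ p) (suc v) = cong suc (insertAt-outside-∣∣ p v)

v∉insertAt-outside : (p : Subset n) (v : Fin (suc n)) → v ∉ₛ insertAt p v outside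
v∉insertAt-outside p v v∈ with trans (sym (insertAt-lookup p v outside)) ([]=⇒lookup v∈)
... | ()

punchIn∈insertAt : (p : Subset n) (v : Fin (suc n)) → ∀ {b x} →
  punchIn v x ∈ₛ insertAt p v b ⇔ x ∈ₛ p
punchIn∈insertAt p v {b} {x} = mk⇔
  (λ x∈ → lookup⇒[]= x p (trans (sym (insertAt-punchIn p v b x)) ([]=⇒lookup x∈)))
  (λ x∈ → lookup⇒[]= _ _ (trans (insertAt-punchIn p v b x) ([]=⇒lookup x∈)))

∉⇒insertAt : (S : Subset (suc n)) {v : Fin (suc n)} → v ∉ₛ S → ∃[ p ] S ≡ insertAt p v outside
∉⇒insertAt S {v} v∉S with lookupᵥ S v in eq
... | inside  = contradiction (lookup⇒[]= v S eq) v∉S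
... | outside = removeAt S v ,
  trans (sym (insertAt-removeAt S v)) (cong (insertAt (removeAt S v) v) eq)

module Deletion (G : Graph (suc n)) (v : Fin (suc n)) where

  -- Inserting `outside` at `v` is a size-preserving bijection from the subsets of `G - v` onto the
  -- subsets of `G` that avoid `v`; `lift` and `restrict` carry domination across it.
  lift : ∀ {p} → Dominating (G - v) p → DominatesExcept G v (insertAt p v outside)
  lift {p} dom x x≢v with punchOut (≢-sym x≢v) | punchIn-punchOut (≢-sym x≢v)
  ... | x′ | refl with dom x′
  ...   | inj₁ x∈p            = inj₁ (from (punchIn∈insertAt p v) x∈p)
  ...   | inj₂ (y , y∈p , xy) = inj₂ (punchIn v y , from (punchIn∈insertAt p v) y∈p , xy)

  restrict : ∀ {p} → DominatesExcept G v (insertAt p v outside) → Dominating (G - v) p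
  restrict {p} dom x with dom (punchIn v x) (punchInᵢ≢i v x)
  ... | inj₁ x∈ = inj₁ (to (punchIn∈insertAt p v) x∈)
  ... | inj₂ (y , y∈ , xy) with v≢y ← (λ { refl → v∉insertAt-outside p v y∈ })
    with punchOut {i = v} {y} v≢y | punchIn-punchOut {i = v} {y} v≢y
  ...   | y′ | refl = inj₂ (y′ , to (punchIn∈insertAt p v) y∈ , xy)

  smallest-without-v : ∃[ D ] (v ∉ₛ D × DominatesExcept G v D × ∣ D ∣ ≡ γ (G - v))
  smallest-without-v with γ-minimum (G - v)
  ... | (p , dom , ∣p∣≡γ) , _ =
    insertAt p v outside , v∉insertAt-outside p v , lift dom , trans (insertAt-outside-∣∣ p v) ∣p∣≡γ

  γ-deletion≤ : ∀ {S} → v ∉ₛ S → DominatesExcept G v S → γ (G - v) ≤ ∣ S ∣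
  γ-deletion≤ {S} v∉S dom with ∉⇒insertAt S v∉S
  ... | p , refl = ≤-trans (proj₂ (γ-minimum (G - v)) p (restrict dom))
                           (≤-reflexive (sym (insertAt-outside-∣∣ p v)))

-- Attaching a leaf

module Leaf (G : Graph n) (v : Fin n) where
  open Domination G v

  γ-addLeaf≤ : ∀ {S} → Dominating G S → v ∈ₛ S → γ (addLeaf G v) ≤ ∣ S ∣
  γ-addLeaf≤ {S} dom v∈S = proj₂ (γ-minimum (addLeaf G v)) (outside ∷ S) λ where
    zero    → inj₂ (suc v , there v∈S , refl)
    (suc x) → [ inj₁ ∘ there , (λ (y , y∈S , xy) → inj₂ (suc y , there y∈S , xy)) ]′ (dom x)

  -- If a minimum dominating set of the extended graph contains the leaf, the leaf is traded for
  -- `v`, which dominates both. Otherwise the leaf is dominated by its only neighbour `v`.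
  smallest-with-v : ∃[ S ] (Dominating G S × v ∈ₛ S × ∣ S ∣ ≤ γ (addLeaf G v))
  smallest-with-v with γ-minimum (addLeaf G v)
  ... | (inside ∷ S , dom , ∣S∣≡γ) , _ =
    S ∪ ⁅ v ⁆ , dominating-∪ domS (inj₁ refl) , q⊆p∪q S ⁅ v ⁆ (x∈⁅x⁆ v)
    , ≤-trans (∣p∪⁅x⁆∣≤1+∣p∣ S v) (≤-reflexive ∣S∣≡γ)
    where
    domS : DominatesExcept G v S
    domS x x≢v with dom (suc x)
    ... | inj₁ x∈S                        = inj₁ (drop-there x∈S)
    ... | inj₂ (zero  , _   , x≡v)        = contradiction x≡v x≢v
    ... | inj₂ (suc y , y∈S , xy)         = inj₂ (y , drop-there y∈S , xy)
  ... | (outside ∷ S , dom , ∣S∣≡γ) , _ = S , domS , v∈S (dom zero) , ≤-reflexive ∣S∣≡γ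
    where
    v∈S : zero ∈ₛ outside ∷ S ⊎ (∃[ y ] (y ∈ₛ outside ∷ S × Adj (addLeaf G v) zero y)) → v ∈ₛ S
    v∈S (inj₂ (suc y , y∈S , refl)) = drop-there y∈S

    domS : Dominating G S
    domS x with dom (suc x)
    ... | inj₁ x∈S                = inj₁ (drop-there x∈S)
    ... | inj₂ (suc y , y∈S , xy) = inj₂ (y , drop-there y∈S , xy)

  γ≤γ-addLeaf : γ G ≤ γ (addLeaf G v)
  γ≤γ-addLeaf with smallest-with-v
  ... | _ , dom , _ , ≤γ = ≤-trans (γ≤ dom) ≤γ

  γ-addLeaf≤1+γ : γ (addLeaf G v) ≤ suc (γ G)
  γ-addLeaf≤1+γ with γ-minimum G
  ... | (S , dom , ∣S∣≡γ) , _ = ≤-trans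
    (γ-addLeaf≤ (dominating-∪ (λ x _ → dom x) (inj₁ refl)) (q⊆p∪q S ⁅ v ⁆ (x∈⁅x⁆ v)))
    (≤-trans (∣p∪⁅x⁆∣≤1+∣p∣ S v) (s≤s (≤-reflexive ∣S∣≡γ)))

  corona⇔γ-addLeaf≡γ : v ∈ corona G ⇔ γ (addLeaf G v) ≡ γ G
  corona⇔γ-addLeaf≡γ = mk⇔
    (λ (S , (dom , ∣S∣≡γ) , v∈S) →
      ≤-antisym (≤-trans (γ-addLeaf≤ dom v∈S) (≤-reflexive ∣S∣≡γ)) γ≤γ-addLeaf)
    (λ γ′≡γ → let S , dom , v∈S , ≤γ′ = smallest-with-v in
      S , dominating⇒mds dom (≤-trans ≤γ′ (≤-reflexive γ′≡γ)) , v∈S)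

  -- Adding a leaf raises γ by 0 or 1, and the first case characterises the corona.
  anticore⇔γ-addLeaf≡γ+1 : v ∈ anticore G ⇔ γ (addLeaf G v) ≡ γ G + 1
  anticore⇔γ-addLeaf≡γ+1 = mk⇔
    (λ v∉corona → trans
      (≤-antisym γ-addLeaf≤1+γ
        (≤∧≢⇒< γ≤γ-addLeaf (v∉corona ∘ from corona⇔γ-addLeaf≡γ ∘ sym)))
      (+-comm 1 (γ G)))
    (λ γ′≡γ+1 v∈corona → m≢1+m+n (γ G)
      (trans (sym (to corona⇔γ-addLeaf≡γ v∈corona)) (trans γ′≡γ+1 (+-suc (γ G) 0))))

-- The three classes

module _ (G : Graph (suc n)) (v : Fin (suc n)) where
  open Domination G v
  open Deletion G v

  -- An mds avoiding `v` would still dominate `G - v`.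
  V⁺⇒core : v ∈ V⁺ G → v ∈ core G
  V⁺⇒core v∈V⁺ S (dom , ∣S∣≡γ) = decidable-stable (v ∈? S) λ v∉S →
    <⇒≱ v∈V⁺ (≤-trans (γ-deletion≤ v∉S (λ x _ → dom x)) (≤-reflexive ∣S∣≡γ))

  core⇒V⁺ : Connected G → Chordal G → ∃ (Adj G v) → v ∈ core G → v ∈ V⁺ G
  core⇒V⁺ connected chordal neighbour v∈core with smallest-without-v
  ... | _ , v∉D , dom , ∣D∣≡γ =
    ≤-trans (core⇒γ<∣D∣ connected chordal neighbour v∈core v∉D dom) (≤-reflexive ∣D∣≡γ)

  -- Adding `v` to a minimum dominating set of `G - v` costs at most one vertex, which the drop in γ
  -- allows.
  V⁻⇒corona : v ∈ V⁻ G → v ∈ corona G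
  V⁻⇒corona v∈V⁻ with smallest-without-v
  ... | D , _ , dom , ∣D∣≡γ =
    _ , dominating⇒mds (dominating-∪ dom (inj₁ refl))
          (≤-trans (∣p∪⁅x⁆∣≤1+∣p∣ D v) (subst (_< γ G) (sym ∣D∣≡γ) v∈V⁻))
      , q⊆p∪q D ⁅ v ⁆ (x∈⁅x⁆ v)

has-neighbour : (G : Graph (2 + n)) → Connected G → ∀ v → ∃ (Adj G v)
has-neighbour G connected v = first (connected v (punchIn v zero)) (≢-sym (punchInᵢ≢i v zero))
  where
  first : ∀ {y} → Star (Adj G) v y → v ≢ y → ∃ (Adj G v)
  first ε        v≢v = contradiction refl v≢v
  first (vx ◅ _) _   = _ , vx

theorem6 : (n : ℕ) (G : Graph n) → 2 ≤ n → Connected G → Chordal G → (v : Fin n) →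
    (v ∈ core G ⇔ v ∈ V⁺ G)
    × (v ∈ anticore G ⇔ γ (addLeaf G v) ≡ γ G + 1)
    × (v ∈ (corona G ∖ core G) ⇔ (v ∈ V⁻ G ⊎ (v ∈ V⁰ G × γ (addLeaf G v) ≡ γ G)))
theorem6 (suc (suc n)) G (s≤s (s≤s z≤n)) connected chordal v =
  core⇔V⁺ , anticore⇔γ-addLeaf≡γ+1 , mk⇔ classify unclassify
  where
  open Leaf G v

  core⇔V⁺ : v ∈ core G ⇔ v ∈ V⁺ G
  core⇔V⁺ = mk⇔ (core⇒V⁺ G v connected chordal (has-neighbour G connected v)) (V⁺⇒core G v)

  classify : v ∈ (corona G ∖ core G) → v ∈ V⁻ G ⊎ (v ∈ V⁰ G × γ (addLeaf G v) ≡ γ G)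
  -- By (1), leaving the core means γ(G - v) ≤ γ(G); the two alternatives are strict inequality and
  -- equality.
  classify (v∈corona , v∉core) = Sum.map id (_, to corona⇔γ-addLeaf≡γ v∈corona)
    (m≤n⇒m<n∨m≡n (≮⇒≥ (v∉core ∘ from core⇔V⁺)))

  unclassify : v ∈ V⁻ G ⊎ (v ∈ V⁰ G × γ (addLeaf G v) ≡ γ G) → v ∈ (corona G ∖ core G)
  unclassify (inj₁ v∈V⁻) = V⁻⇒corona G v v∈V⁻ , <-asym v∈V⁻ ∘ to core⇔V⁺
  unclassify (inj₂ (v∈V⁰ , γ′≡γ)) =
    from corona⇔γ-addLeaf≡γ γ′≡γ , <-irrefl (sym v∈V⁰) ∘ to core⇔V⁺
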